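{- Suppose $\mathcal D=(\mathcal P,\mathcal B,\mathcal I)$ is a non-trivial $G$-pairwise transitive $2$-design, where $G\le\mathrm{Aut}(\mathcal D)$. Then $\mathcal D$ is connected, and the following properties hold: (a) $G^{\mathcal P}$ is $2$-transitive; (b) either $G^{\mathcal B}$ is $2$-transitive, or $G^{\mathcal B}$ is transitive of rank $3$ and $\mathcal D$ has non-intersecting blocks; (c) $G_p$ has two orbits on $\mathcal B$, for any $p\in\mathcal P$; (d) $G_b$ has two orbits on $\mathcal P$, for any $b\in\mathcal B$; (e) $\mathcal D$ has no repeated blocks; (f) if $p_1,p_2$ are distinct points, then $[p_1]\ne[p_2]$; (g) $G$ acts faithfully on $\mathcal P$; (h) $G$ acts faithfully on $\mathcal B$.
   Context: A design $\mathcal D=(\mathcal P,\mathcal B,\mathcal I)$ consists of finite sets $\mathcal P$ (points), $\mathcal B$ (blocks) and an incidence relation $\mathcal I\subseteq\mathcal P\times\mathcal B$. It is a $2$-$(v,k,\lambda)$ design (or $2$-design) if $|\mathcal P|=v$, each block is incident with exactly $k$ points, and each pair of distinct points is incident with exactly $\lambda$ common blocks. It is non-trivial if $2<k<v$. For a point $p$, $[p]$ is the set of blocks incident with $p$; for a block $b$, $[b]$ is the set of points incident with $b$. A block $b$ is repeated if $[b]=[b']$ for some block $b'\ne b$. The design is connected if its incidence graph (vertex set $\mathcal P\cup\mathcal B$, edges the incident point-block pairs) is connected. An automorphism is a permutation of $\mathcal P\cup\mathcal B$ leaving $\mathcal P$ and $\mathcal B$ invariant setwise and preserving incidence; $\mathrm{Aut}(\mathcal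 D)$ is the group of all automorphisms. Two blocks are intersecting if some point is incident with both. For $G\le\mathrm{Aut}(\mathcal D)$, the $2$-design $\mathcal D$ is $G$-pairwise transitive if $G$ is transitive on each of the following five (possibly empty) sets of ordered pairs: pairs of distinct points, incident point-block pairs, non-incident point-block pairs, pairs of distinct intersecting blocks, pairs of non-intersecting blocks. $G^{\mathcal P}$ and $G^{\mathcal B}$ are the permutation groups induced by $G$ on $\mathcal P$ and $\mathcal B$; $G_x$ is the stabiliser of $x$. A transitive permutation group has rank $n$ if a point stabiliser has exactly $n$ orbits.
   Formalization: The definition of a 2-(v,k,λ) design is taken to include λ ≥ 1; for λ = 0 and k > 2 only structures without blocks exist, and for these connectedness and (c) fail. -}

module Defs where

open import Algebra.Bundles using (Group)
open import Data.Empty using (⊥; ⊥-elim)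
open import Data.Fin.Base using (Fin)
open import Data.List.Base using (List; tabulate; filter; length)
open import Data.Nat.Base using (ℕ; _<_; _≤_)
open import Data.Product.Base using (Σ; ∃-syntax; _×_; _,_; proj₁; proj₂)
open import Data.Sum.Base using (_⊎_; inj₁; inj₂)
open import Data.Sum.Properties using (inj₁-injective; inj₂-injective)
open import Function.Base using (_∘_)
open import Function.Bundles using (Inverse; _↔_; _⇔_; mk⇔; Equivalence)
open import Function.Construct.Composition using (_↔-∘_)
open import Function.Construct.Identity using (↔-id)
open import Function.Construct.Symmetry using (↔-sym)
open import Level using (Level; 0ℓ; _⊔_) renaming (suc to lsuc)
open import Relation.Binary.Construct.Closure.ReflexiveTransitive using (Star)
open import Relation.Binary.Core using (REL; Rel)
open import Relation.Binary.Definitions using () renaming (Decidable to Decidable₂)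
open import Relation.Binary.PropositionalEquality using (_≡_; _≢_; refl; sym; trans; cong; cong₂; subst₂)
open import Relation.Nullary.Decidable using (_×-dec_)
open import Relation.Nullary.Negation using (¬_)
open import Relation.Unary using (Pred; Decidable; _∈_; _≐_)

private
  variable
    c ℓ m x y s : Level

open Inverse using (to; from; strictlyInverseˡ; strictlyInverseʳ)

record Subgroup (A : Group c ℓ) (m : Level) : Set (c ⊔ ℓ ⊔ lsuc m) where
  open Group A hiding (refl; sym; trans)
  field
    Member    : Pred Carrier m
    resp      : ∀ {g h} → g ≈ h → g ∈ Member → h ∈ Member
    ε-closed  : ε ∈ Member
    ∙-closed  : ∀ {g h} → g ∈ Member → h ∈ Member → (g ∙ h) ∈ Member
    ⁻¹-closed : ∀ {g} → g ∈ Member → (g ⁻¹) ∈ Member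

record Action (A : Group c ℓ) (X : Set x) : Set (c ⊔ ℓ ⊔ x) where
  open Group A hiding (refl; sym; trans)
  infixr 7 _·_
  field
    _·_        : Carrier → X → X
    ·-cong     : ∀ {g h} → g ≈ h → ∀ z → g · z ≡ h · z
    ·-identity : ∀ z → ε · z ≡ z
    ·-assoc    : ∀ g h z → (g ∙ h) · z ≡ g · (h · z)

module _ {A : Group c ℓ} where
  open Group A hiding (refl; sym; trans)

  _×-action_ : {X : Set x} {Y : Set y} → Action A X → Action A Y → Action A (X × Y)
  α ×-action β = record
    { _·_        = λ g (u , w) → (g α.· u) , (g β.· w)
    ; ·-cong     = λ e (u , w) → cong₂ _,_ (α.·-cong e u) (β.·-cong e w)
    ; ·-identity = λ (u , w) → cong₂ _,_ (α.·-identity u) (β.·-identity w)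
    ; ·-assoc    = λ g h (u , w) → cong₂ _,_ (α.·-assoc g h u) (β.·-assoc g h w)
    }
    where
    module α = Action α
    module β = Action β

  module _ (H : Subgroup A m) {X : Set x} (α : Action A X) where
    open Subgroup H
    open Action α

    SameOrbit : Rel X (c ⊔ m ⊔ x)
    SameOrbit u w = ∃[ g ] (g ∈ Member × g · u ≡ w)

    -- The set S is not required to be non-empty.
    TransitiveOn : Pred X s → Set (c ⊔ m ⊔ x ⊔ s)
    TransitiveOn S = ∀ u w → u ∈ S → w ∈ S → SameOrbit u w

    Transitive : Set (c ⊔ m ⊔ x)
    Transitive = ∀ u w → SameOrbit u w

    -- Exactly n orbits: a complete, irredundant system of n representatives.
    HasOrbits : ℕ → Set (c ⊔ m ⊔ x)
    HasOrbits n = Σ (Fin n → X) λ rep →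
      (∀ i j → i ≢ j → ¬ SameOrbit (rep i) (rep j)) ×
      (∀ w → ∃[ i ] SameOrbit (rep i) w)

    Faithful : Set (c ⊔ ℓ ⊔ m ⊔ x)
    Faithful = ∀ g → g ∈ Member → (∀ u → g · u ≡ u) → g ≈ ε

    stabiliser : X → Subgroup A (m ⊔ x)
    stabiliser u = record
      { Member    = λ g → g ∈ Member × g · u ≡ u
      ; resp      = λ e (g∈ , fix) → resp e g∈ , trans (sym (·-cong e u)) fix
      ; ε-closed  = ε-closed , ·-identity u
      ; ∙-closed  = λ {g} {h} (g∈ , gu) (h∈ , hu) →
          ∙-closed g∈ h∈ , trans (·-assoc g h u) (trans (cong (g ·_) hu) gu)
      ; ⁻¹-closed = λ {g} (g∈ , gu) →
          ⁻¹-closed g∈ ,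
          trans (cong (g ⁻¹ ·_) (sym gu))
            (trans (sym (·-assoc (g ⁻¹) g u))
              (trans (·-cong (inverseˡ g) u) (·-identity u)))
      }

-- Permutations are compared pointwise; (π ∙ ρ) applies ρ first.
Sym : Set x → Group x x
Sym X = record
  { Carrier = X ↔ X
  ; _≈_     = λ π ρ → ∀ z → to π z ≡ to ρ z
  ; _∙_     = _↔-∘_
  ; ε       = ↔-id X
  ; _⁻¹     = ↔-sym
  ; isGroup = record
    { isMonoid = record
      { isSemigroup = record
        { isMagma = record
          { isEquivalence = record
            { refl  = λ _ → refl
            ; sym   = λ e z → sym (e z)
            ; trans = λ e f z → trans (e z) (f z)
            }
          ; ∙-cong = λ {_} {π} {ρ} e f z → trans (e _) (cong (to π) (f z))
          }
        ; assoc = λ _ _ _ _ → refl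
        }
      ; identity = (λ _ _ → refl) , (λ _ _ → refl)
      }
    ; inverse = strictlyInverseʳ , strictlyInverseˡ
    ; ⁻¹-cong = λ {π} {ρ} e z →
        trans (cong (from π) (sym (strictlyInverseˡ ρ z)))
          (trans (cong (from π) (sym (e (from ρ z)))) (strictlyInverseʳ π (from ρ z)))
    }
  }

PermutationGroup : Set x → (m : Level) → Set (x ⊔ lsuc m)
PermutationGroup X m = Subgroup (Sym X) m

natural : (X : Set x) → Action (Sym X) X
natural X = record
  { _·_        = to
  ; ·-cong     = λ e → e
  ; ·-identity = λ _ → refl
  ; ·-assoc    = λ _ _ _ → refl
  }

-- The permutation group Hˣ induced by H on X.
induced : {A : Group c ℓ} → Subgroup A m → {X : Set x} → Action A X →
          PermutationGroup X (c ⊔ m ⊔ x)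
induced {A = A} H α = record
  { Member    = λ π → ∃[ g ] (g ∈ Member × (∀ z → to π z ≡ g · z))
  ; resp      = λ e (g , g∈ , h) → g , g∈ , λ z → trans (sym (e z)) (h z)
  ; ε-closed  = ε , ε-closed , λ z → sym (·-identity z)
  ; ∙-closed  = λ (g , g∈ , e) (h , h∈ , f) → (g ∙ h) , ∙-closed g∈ h∈ ,
      λ z → trans (e _) (trans (cong (g ·_) (f z)) (sym (·-assoc g h z)))
  ; ⁻¹-closed = λ {π} (g , g∈ , e) → (g ⁻¹) , ⁻¹-closed g∈ , λ z →
      trans (sym (·-identity (from π z)))
        (trans (sym (·-cong (inverseˡ g) (from π z)))
          (trans (·-assoc (g ⁻¹) g (from π z))
            (cong (g ⁻¹ ·_) (trans (sym (e (from π z))) (strictlyInverseˡ π z)))))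
  }
  where
  open Group A hiding (refl; sym; trans)
  open Subgroup H
  open Action α

Distinct : {X : Set x} → Pred (X × X) x
Distinct (u , w) = u ≢ w

module _ {X : Set x} (H : PermutationGroup X m) where

  IsTransitive : Set (x ⊔ m)
  IsTransitive = Transitive H (natural X)

  Is2Transitive : Set (x ⊔ m)
  Is2Transitive = TransitiveOn H (natural X ×-action natural X) Distinct

  IsTransitiveOfRank : ℕ → Set (x ⊔ m)
  IsTransitiveOfRank n =
    IsTransitive × (∀ u → HasOrbits (stabiliser H (natural X) u) (natural X) n)

record Finite (X : Set) : Set where
  field
    size : ℕ
    enum : X ↔ Fin size

  elements : List X
  elements = tabulate (from enum)

  count : {S : Pred X 0ℓ} → Decidable S → ℕ
  count S? = length (filter S? elements)

-- Incidence is decidable, as any relation between finite sets classically is.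
record Design : Set₁ where
  infix 4 _I_ _I?_
  field
    Point        : Set
    Block        : Set
    point-finite : Finite Point
    block-finite : Finite Block
    _I_          : REL Point Block 0ℓ
    _I?_         : Decidable₂ _I_

  module P = Finite point-finite
  module B = Finite block-finite

  [_]ᵖ : Point → Pred Block 0ℓ
  [ p ]ᵖ b = p I b

  [_]ᵇ : Block → Pred Point 0ℓ
  [ b ]ᵇ p = p I b

  Intersecting : Rel Block 0ℓ
  Intersecting b b′ = ∃[ p ] (p I b × p I b′)

  Repeated : Pred Block 0ℓ
  Repeated b = ∃[ b′ ] (b′ ≢ b × [ b ]ᵇ ≐ [ b′ ]ᵇ)

  HasNonIntersectingBlocks : Set
  HasNonIntersectingBlocks = ∃[ b ] ∃[ b′ ] ¬ Intersecting b b′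

  -- P ∪ B is a disjoint union.
  Vertex : Set
  Vertex = Point ⊎ Block

  Adjacent : Rel Vertex 0ℓ
  Adjacent (inj₁ p) (inj₂ b) = p I b
  Adjacent (inj₂ b) (inj₁ p) = p I b
  Adjacent (inj₁ _) (inj₁ _) = ⊥
  Adjacent (inj₂ _) (inj₂ _) = ⊥

  Connected : Set
  Connected = ∀ u w → Star Adjacent u w

  -- λ is positive by the usual convention on design parameters.  For λ = 0
  -- and k ≥ 2 the definition would only admit structures without blocks.
  record Is2Design (v k λ′ : ℕ) : Set where
    field
      λ-positive  : 1 ≤ λ′
      point-count : P.size ≡ v
      block-size  : ∀ b → P.count (λ p → p I? b) ≡ k
      pair-count  : ∀ p q → p ≢ q → B.count (λ b → (p I? b) ×-dec (q I? b)) ≡ λ′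

  record IsNonTrivial2Design : Set where
    field
      v k λ′      : ℕ
      is2Design   : Is2Design v k λ′
      2<k         : 2 < k
      k<v         : k < v

  record Automorphism : Set where
    field
      perm   : Vertex ↔ Vertex
      points : ∀ p → ∃[ q ] to perm (inj₁ p) ≡ inj₁ q
      blocks : ∀ b → ∃[ d ] to perm (inj₂ b) ≡ inj₂ d

    onPoint : Point → Point
    onPoint p = proj₁ (points p)

    onBlock : Block → Block
    onBlock b = proj₁ (blocks b)

    field
      incidence : ∀ p b → p I b ⇔ onPoint p I onBlock b

  open Automorphism

  private
    module V = Group (Sym Vertex)

    idᵃ : Automorphism
    idᵃ = record
      { perm      = V.ε
      ; points    = λ p → p , refl
      ; blocks    = λ b → b , refl
      ; incidence = λ _ _ → mk⇔ (λ i → i) (λ i → i)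
      }

    _∘ᵃ_ : Automorphism → Automorphism → Automorphism
    g ∘ᵃ h = record
      { perm      = perm g V.∙ perm h
      ; points    = λ p → onPoint g (onPoint h p) ,
          trans (cong (to (perm g)) (proj₂ (points h p))) (proj₂ (points g _))
      ; blocks    = λ b → onBlock g (onBlock h b) ,
          trans (cong (to (perm g)) (proj₂ (blocks h b))) (proj₂ (blocks g _))
      ; incidence = λ p b → mk⇔
          (Equivalence.to (incidence g _ _) ∘ Equivalence.to (incidence h p b))
          (Equivalence.from (incidence h p b) ∘ Equivalence.from (incidence g _ _))
      }

    module _ (g : Automorphism) where

      inj₁≢inj₂ : ∀ {p : Point} {b : Block} → inj₁ p ≢ inj₂ b
      inj₁≢inj₂ ()

      points⁻¹ : ∀ p → ∃[ q ] from (perm g) (inj₁ p) ≡ inj₁ q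
      points⁻¹ p with from (perm g) (inj₁ p) in eq
      ... | inj₁ q = q , refl
      ... | inj₂ d = ⊥-elim (inj₁≢inj₂
              (trans (sym (strictlyInverseˡ (perm g) (inj₁ p)))
                (trans (cong (to (perm g)) eq) (proj₂ (blocks g d)))))

      blocks⁻¹ : ∀ b → ∃[ d ] from (perm g) (inj₂ b) ≡ inj₂ d
      blocks⁻¹ b with from (perm g) (inj₂ b) in eq
      ... | inj₂ d = d , refl
      ... | inj₁ q = ⊥-elim (inj₁≢inj₂ (sym
              (trans (sym (strictlyInverseˡ (perm g) (inj₂ b)))
                (trans (cong (to (perm g)) eq) (proj₂ (points g q))))))

      onPoint-inv : ∀ p → onPoint g (proj₁ (points⁻¹ p)) ≡ p
      onPoint-inv p = inj₁-injective
        (trans (sym (proj₂ (points g _)))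
          (trans (cong (to (perm g)) (sym (proj₂ (points⁻¹ p))))
            (strictlyInverseˡ (perm g) (inj₁ p))))

      onBlock-inv : ∀ b → onBlock g (proj₁ (blocks⁻¹ b)) ≡ b
      onBlock-inv b = inj₂-injective
        (trans (sym (proj₂ (blocks g _)))
          (trans (cong (to (perm g)) (sym (proj₂ (blocks⁻¹ b))))
            (strictlyInverseˡ (perm g) (inj₂ b))))

      _⁻¹ᵃ : Automorphism
      _⁻¹ᵃ = record
        { perm      = perm g V.⁻¹
        ; points    = points⁻¹
        ; blocks    = blocks⁻¹
        ; incidence = λ p b → mk⇔
            (λ i → Equivalence.from (incidence g _ _)
              (subst₂ _I_ (sym (onPoint-inv p)) (sym (onBlock-inv b)) i))
            (λ i → subst₂ _I_ (onPoint-inv p) (onBlock-inv b)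
              (Equivalence.to (incidence g _ _) i))
        }

  Aut : Group 0ℓ 0ℓ
  Aut = record
    { Carrier = Automorphism
    ; _≈_     = λ g h → perm g V.≈ perm h
    ; _∙_     = _∘ᵃ_
    ; ε       = idᵃ
    ; _⁻¹     = _⁻¹ᵃ
    ; isGroup = record
      { isMonoid = record
        { isSemigroup = record
          { isMagma = record
            { isEquivalence = record
              { refl  = λ _ → refl
              ; sym   = λ e z → sym (e z)
              ; trans = λ e f z → trans (e z) (f z)
              }
            ; ∙-cong = λ {g} {g′} {h} {h′} →
                V.∙-cong {perm g} {perm g′} {perm h} {perm h′}
            }
          ; assoc = λ _ _ _ _ → refl
          }
        ; identity = (λ _ _ → refl) , (λ _ _ → refl)
        }
      ; inverse = (λ g → V.inverseˡ (perm g)) , (λ g → V.inverseʳ (perm g))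
      ; ⁻¹-cong = λ {g} {h} → V.⁻¹-cong {perm g} {perm h}
      }
    }

  pointAction : Action Aut Point
  pointAction = record
    { _·_        = onPoint
    ; ·-cong     = λ {g} {h} e p → inj₁-injective
        (trans (sym (proj₂ (points g p))) (trans (e (inj₁ p)) (proj₂ (points h p))))
    ; ·-identity = λ _ → refl
    ; ·-assoc    = λ _ _ _ → refl
    }

  blockAction : Action Aut Block
  blockAction = record
    { _·_        = onBlock
    ; ·-cong     = λ {g} {h} e b → inj₂-injective
        (trans (sym (proj₂ (blocks g b))) (trans (e (inj₂ b)) (proj₂ (blocks h b))))
    ; ·-identity = λ _ → refl
    ; ·-assoc    = λ _ _ _ → refl
    }

  record PairwiseTransitive (G : Subgroup Aut m) : Set m where
    field
      distinct-points        : TransitiveOn G (pointAction ×-action pointAction) Distinct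
      incident-pairs         : TransitiveOn G (pointAction ×-action blockAction)
                                 (λ (p , b) → p I b)
      nonincident-pairs      : TransitiveOn G (pointAction ×-action blockAction)
                                 (λ (p , b) → ¬ (p I b))
      intersecting-blocks    : TransitiveOn G (blockAction ×-action blockAction)
                                 (λ (b , d) → b ≢ d × Intersecting b d)
      nonintersecting-blocks : TransitiveOn G (blockAction ×-action blockAction)
                                 (λ (b , d) → ¬ Intersecting b d)

{-# OPTIONS --safe #-}
-- Everything rests on two facts: every block has points on and off it, and any two
-- points share a block.  A block through a point on b and a point off b meets b but
-- differs from it as a point set, so by transitivity on intersecting pairs no two blocks have
-- equal point sets; dually, a block separates some pair of points, hence every pair.
-- Faithfulness follows, and the orbits of the stabilisers are read off from
-- transitivity on the five classes of pairs.
module Submission where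

open import Defs
open import Algebra.Bundles using (Group)
open import Data.Empty using (⊥-elim)
open import Data.Fin.Base using (Fin; zero; suc)
import Data.Fin.Properties as Fin
open import Data.List.Base using (length)
open import Data.List.Properties using (filter-all; filter-none; length-tabulate)
open import Data.List.Relation.Unary.All.Properties using (tabulate⁺)
open import Data.Nat.Base using (_<_; z<s; s<s)
open import Data.Nat.Properties using (<-trans; <-irrefl)
open import Data.Product using (_×_; _,_; ∃-syntax; proj₁; proj₂; swap)
open import Data.Sum using (_⊎_; inj₁; inj₂)
open import Function.Base using (_∘_; flip)
open import Function.Bundles using (Inverse; _↔_; mk↔ₛ′; Equivalence)
open import Level using (Level; 0ℓ)
open import Relation.Binary.Construct.Closure.ReflexiveTransitive using (Star; _◅_; _◅◅_) renaming (ε to [])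
open import Relation.Binary.Core using (REL)
open import Relation.Binary.Definitions using (DecidableEquality)
open import Relation.Binary.PropositionalEquality using (_≡_; _≢_; refl; sym; trans; cong; cong₂; subst; subst₂)
open import Relation.Nullary using (¬_; Dec; yes; no)
open import Relation.Nullary.Decidable using (map′; _×-dec_; ¬?; decidable-stable)
open import Relation.Unary using (Pred; Decidable; _∈_; _≐_)

private
  variable
    c ℓ m x y s : Level

-- Finite sets: decidable search and witnesses obtained from counts.

module FiniteProperties {X : Set} (F : Finite X) where
  open Finite F
  open Inverse enum using (to; from; strictlyInverseˡ; strictlyInverseʳ)

  from-injective : ∀ {i j} → from i ≡ from j → i ≡ j
  from-injective {i} {j} e =
    trans (sym (strictlyInverseˡ i)) (trans (cong to e) (strictlyInverseˡ j))

  infix 4 _≟_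
  _≟_ : DecidableEquality X
  u ≟ w = map′
    (λ e → trans (sym (strictlyInverseʳ u)) (trans (cong from e) (strictlyInverseʳ w)))
    (cong to) (to u Fin.≟ to w)

  any? : {S : Pred X s} → Decidable S → Dec (∃[ u ] S u)
  any? {S = S} S? = map′
    (λ (i , Si) → from i , Si)
    (λ (u , Su) → to u , subst S (sym (strictlyInverseʳ u)) Su)
    (Fin.any? (S? ∘ from))

  module _ {S : Pred X 0ℓ} (S? : Decidable S) where

    -- Finite search makes existence decidable, so it suffices to refute its failure: with no
    -- witness the filter would return the empty list, of length 0.
    0<count⇒∃ : 0 < count S? → ∃[ u ] S u
    0<count⇒∃ 0<n = decidable-stable (any? S?) λ ∄ →
      <-irrefl (sym (cong length (filter-none S? (tabulate⁺ λ i Si → ∄ (from i , Si))))) 0<n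

    count<size⇒∃¬ : count S? < size → ∃[ u ] (¬ S u)
    count<size⇒∃¬ n<size = decidable-stable (any? (¬? ∘ S?)) λ ∄ →
      <-irrefl
        (trans
          (cong length (filter-all S?
            (tabulate⁺ λ i → decidable-stable (S? _) λ ¬Si → ∄ (from i , ¬Si))))
          (length-tabulate from))
        n<size

  -- If every element equalled `u`, two distinct indices would enumerate the same element.
  1<size⇒∃≢ : 1 < size → ∀ u → ∃[ w ] u ≢ w
  1<size⇒∃≢ 1<size u = decidable-stable (any? (¬? ∘ (u ≟_))) λ ∄ →
    let all-u = λ w → decidable-stable (u ≟ w) λ u≢w → ∄ (w , u≢w)
        i , j , i≢j = two 1<size
    in i≢j (from-injective (trans (sym (all-u (from i))) (all-u (from j))))
    where
    two : ∀ {n} → 1 < n → ∃[ i ] ∃[ j ] (_≢_ {A = Fin n} i j)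
    two (s<s z<s) = zero , suc zero , λ ()

-- Group actions: induced permutation groups and orbits of stabilisers.

module _ {A : Group c ℓ} where
  open Group A hiding (refl; sym; trans)

  module _ {X : Set x} (α : Action A X) where
    open Action α

    -- Members of an induced group are bijections of `X`, so each group element has to be packaged
    -- as one; the two inverse laws also serve later to cancel `g` against `g ⁻¹`.
    permutation : Carrier → X ↔ X
    permutation g = mk↔ₛ′ (g ·_) ((g ⁻¹) ·_) (cancel (inverseʳ g)) (cancel (inverseˡ g))
      where
      cancel : ∀ {g h} → g ∙ h ≈ ε → ∀ z → g · (h · z) ≡ z
      cancel {g} {h} e z = trans (sym (·-assoc g h z)) (trans (·-cong e z) (·-identity z))

  module _ (H : Subgroup A m) {X : Set x} (α : Action A X) where
    open Subgroup H
    open Action α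

    permutation∈induced : ∀ {g} → g ∈ Member → permutation α g ∈ Subgroup.Member (induced H α)
    permutation∈induced {g} g∈ = g , g∈ , λ _ → refl

    induced-transitive : Transitive H α → IsTransitive (induced H α)
    induced-transitive tr u w =
      let g , g∈ , gu = tr u w in permutation α g , permutation∈induced g∈ , gu

    induced-2-transitive : TransitiveOn H (α ×-action α) Distinct → Is2Transitive (induced H α)
    induced-2-transitive tr u w du dw =
      let g , g∈ , gu = tr u w du dw in permutation α g , permutation∈induced g∈ , gu

    -- A permutation in the induced stabiliser agrees pointwise with some `g` fixing `u`, and each
    -- such `g` induces one, so the same representatives serve.
    induced-stabiliser-orbits : ∀ {n} u → HasOrbits (stabiliser H α u) α n →
      HasOrbits (stabiliser (induced H α) (natural X) u) (natural X) n
    induced-stabiliser-orbits u (rep , irredundant , complete) = rep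
      , (λ i j i≢j (π , ((g , g∈ , π≗g) , πu) , πi) →
          irredundant i j i≢j
            (g , (g∈ , trans (sym (π≗g u)) πu) , trans (sym (π≗g (rep i))) πi))
      , (λ w → let i , g , (g∈ , gu) , gi = complete w in
          i , permutation α g , (permutation∈induced g∈ , gu) , gi)

    module _ {Y : Set y} (β : Action A Y) where
      private module β = Action β

      TransitiveOn-swap : {S : Pred (X × Y) s} →
        TransitiveOn H (α ×-action β) S → TransitiveOn H (β ×-action α) (S ∘ swap)
      TransitiveOn-swap tr u w Su Sw =
        let g , g∈ , e = tr (swap u) (swap w) Su Sw in g , g∈ , cong swap e

      -- If the invariant relations R i split X × Y into the orbits of H, then the orbits of
      -- the stabiliser of u on Y are the sets of w with R i u w.
      stabiliser-orbits : ∀ {n} (R : Fin n → REL X Y s) →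
        (∀ i {g u w} → g ∈ Member → R i u w → R i (g · u) (g β.· w)) →
        (∀ i → TransitiveOn H (α ×-action β) (λ (u , w) → R i u w)) →
        (∀ i j {u w} → R i u w → R j u w → i ≡ j) →
        (∀ u w → ∃[ i ] R i u w) →
        (∀ i u → ∃[ w ] R i u w) →
        ∀ u → HasOrbits (stabiliser H α u) β n
      stabiliser-orbits R invariant transitive disjoint cover inhabited u =
        (λ i → proj₁ (inhabited i u))
        , (λ i j i≢j (g , (g∈ , gu) , gi) → i≢j (disjoint i j
            (subst₂ (R i) gu gi (invariant i g∈ (proj₂ (inhabited i u))))
            (proj₂ (inhabited j u))))
        , λ w → let i , r = cover u w
                    g , g∈ , e = transitive i (u , _) (u , w) (proj₂ (inhabited i u)) r
                in i , g , (g∈ , cong proj₁ e) , cong proj₂ e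

      -- The two classes are `R` and its complement: decidability makes them cover, and the
      -- complement is invariant by the contrapositive of `reflect`.
      stabiliser-2-orbits : (R : REL X Y s) →
        (∀ u w → Dec (R u w)) →
        (∀ {g u w} → g ∈ Member → R u w → R (g · u) (g β.· w)) →
        (∀ {g u w} → g ∈ Member → R (g · u) (g β.· w) → R u w) →
        TransitiveOn H (α ×-action β) (λ (u , w) → R u w) →
        TransitiveOn H (α ×-action β) (λ (u , w) → ¬ R u w) →
        (∀ u → ∃[ w ] R u w) →
        (∀ u → ∃[ w ] (¬ R u w)) →
        ∀ u → HasOrbits (stabiliser H α u) β 2
      stabiliser-2-orbits {s = s} R R? preserve reflect tr tr¬ ex ex¬ =
        stabiliser-orbits Rel₂
          (λ { zero → preserve ; (suc zero) g∈ ¬r → ¬r ∘ reflect g∈ })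
          (λ { zero → tr ; (suc zero) → tr¬ })
          (λ { zero zero _ _ → refl
             ; zero (suc zero) r ¬r → ⊥-elim (¬r r)
             ; (suc zero) zero ¬r r → ⊥-elim (¬r r)
             ; (suc zero) (suc zero) _ _ → refl })
          cover
          (λ { zero → ex ; (suc zero) → ex¬ })
        where
        Rel₂ : Fin 2 → REL X Y s
        Rel₂ zero       = R
        Rel₂ (suc zero) = λ u w → ¬ R u w

        cover : ∀ u w → ∃[ i ] Rel₂ i u w
        cover u w with R? u w
        ... | yes r = zero , r
        ... | no ¬r = suc zero , ¬r

-- Pairwise transitive designs: incidence and existence of points and blocks.

module PairwiseTransitiveDesign {m : Level} (D : Design) (G : Subgroup (Design.Aut D) m)
  (nontrivial : Design.IsNonTrivial2Design D) (pt : Design.PairwiseTransitive D G) where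

  open Design D
  open IsNonTrivial2Design nontrivial
  open Is2Design is2Design
  open PairwiseTransitive pt
  open Subgroup G
  open Automorphism
  private
    module FP = FiniteProperties point-finite
    module FB = FiniteProperties block-finite

  preserves-I : ∀ g {p b} → p I b → onPoint g p I onBlock g b
  preserves-I g = Equivalence.to (incidence g _ _)

  reflects-I : ∀ g {p b} → onPoint g p I onBlock g b → p I b
  reflects-I g = Equivalence.from (incidence g _ _)

  separated⇒≢ᵖ : ∀ {p q b} → p I b → ¬ q I b → p ≢ q
  separated⇒≢ᵖ pb ¬qb refl = ¬qb pb

  separated⇒≢ᵇ : ∀ {p b d} → ¬ p I b → p I d → b ≢ d
  separated⇒≢ᵇ ¬pb pd refl = ¬pb pd

  point-on : ∀ b → ∃[ p ] p I b
  point-on b = FP.0<count⇒∃ (_I? b) (subst (0 <_) (sym (block-size b)) (<-trans z<s 2<k))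

  point-off : ∀ b → ∃[ p ] (¬ p I b)
  point-off b = FP.count<size⇒∃¬ (_I? b)
    (subst₂ _<_ (sym (block-size b)) (sym point-count) k<v)

  -- This is where the positivity of `λ′` enters.
  common-block : ∀ {p q} → p ≢ q → ∃[ b ] (p I b × q I b)
  common-block {p} {q} p≢q = FB.0<count⇒∃ (λ b → (p I? b) ×-dec (q I? b))
    (subst (0 <_) (sym (pair-count p q p≢q)) λ-positive)

  another-point : ∀ p → ∃[ q ] p ≢ q
  another-point = FP.1<size⇒∃≢
    (subst (1 <_) (sym point-count) (<-trans (<-trans (s<s z<s) 2<k) k<v))

  block-on : ∀ p → ∃[ b ] p I b
  block-on p = let _ , p≢q = another-point p
                   b , pb , _ = common-block p≢q in b , pb

  -- Transitivity on points and on blocks, and intersecting blocks.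

  transitive-on-points : Transitive G pointAction
  transitive-on-points p q =
    let g , g∈ , e = incident-pairs (p , _) (q , _) (proj₂ (block-on p)) (proj₂ (block-on q))
    in g , g∈ , cong proj₁ e

  transitive-on-blocks : Transitive G blockAction
  transitive-on-blocks b d =
    let g , g∈ , e = incident-pairs (_ , b) (_ , d) (proj₂ (point-on b)) (proj₂ (point-on d))
    in g , g∈ , cong proj₂ e

  block-off : ∀ p → ∃[ b ] (¬ p I b)
  block-off p =
    let b , _ = block-on p
        q , ¬qb = point-off b
        g , _ , gp≡q = transitive-on-points p q
        g⁻¹ = Group._⁻¹ Aut g
    -- Since `g` takes `p` to a point off `b`, its inverse takes `b` to a block off `p`.
    in onBlock g⁻¹ b , λ i → ¬qb (subst₂ _I_ gp≡q
         (Inverse.strictlyInverseˡ (permutation blockAction g) b) (preserves-I g i))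

  -- Join a point on `b` to a point off `b`. The point off `b` is kept in the result because it
  -- distinguishes the point sets of the two blocks.
  crossing-block : ∀ b → ∃[ d ] (b ≢ d × Intersecting b d × ∃[ q ] (q I d × ¬ q I b))
  crossing-block b =
    let p , pb = point-on b
        q , ¬qb = point-off b
        d , pd , qd = common-block (separated⇒≢ᵖ pb ¬qb)
    in d , separated⇒≢ᵇ ¬qb qd , (p , pb , pd) , q , qd , ¬qb

  intersecting? : ∀ b d → Dec (Intersecting b d)
  intersecting? b d = FP.any? λ p → (p I? b) ×-dec (p I? d)

  preserves-Intersecting : ∀ g {b d} → Intersecting b d → Intersecting (onBlock g b) (onBlock g d)
  preserves-Intersecting g (p , pb , pd) = onPoint g p , preserves-I g pb , preserves-I g pd

  reflects-Intersecting : ∀ g {b d} → Intersecting (onBlock g b) (onBlock g d) → Intersecting b d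
  reflects-Intersecting g {b} {d} (p , pb , pd) = onPoint g⁻¹ p , back pb , back pd
    where
    g⁻¹ = Group._⁻¹ Aut g
    back : ∀ {b} → p I onBlock g b → onPoint g⁻¹ p I b
    back {b} i = subst (onPoint g⁻¹ p I_)
      (Inverse.strictlyInverseʳ (permutation blockAction g) b) (preserves-I g⁻¹ i)

  onBlock-injective : ∀ g {b d} → onBlock g b ≡ onBlock g d → b ≡ d
  onBlock-injective g {b} {d} e =
    trans (sym (strictlyInverseʳ b))
      (trans (cong (onBlock (Group._⁻¹ Aut g)) e) (strictlyInverseʳ d))
    where open Inverse (permutation blockAction g) using (strictlyInverseʳ)

  -- Connectedness.

  connected : Connected
  connected u w = to-point u ◅◅ between (near u) (near w) ◅◅ from-point w
    where
    near : Vertex → Point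
    near (inj₁ p) = p
    near (inj₂ b) = proj₁ (point-on b)

    to-point : ∀ u → Star Adjacent u (inj₁ (near u))
    to-point (inj₁ p) = []
    to-point (inj₂ b) = proj₂ (point-on b) ◅ []

    from-point : ∀ u → Star Adjacent (inj₁ (near u)) u
    from-point (inj₁ p) = []
    from-point (inj₂ b) = proj₂ (point-on b) ◅ []

    between : ∀ p q → Star Adjacent (inj₁ p) (inj₁ q)
    between p q with p FP.≟ q
    ... | yes refl = []
    ... | no p≢q   = let b , pb , qb = common-block p≢q in
      -- `Adjacent` computes by cases on its arguments, so the middle vertex cannot be inferred from
      -- `pb` and is given explicitly.
      _◅_ {j = inj₂ b} pb (qb ◅ [])

  -- Separation of blocks and of points, and faithfulness.

  no-repeated-blocks : ∀ b → ¬ Repeated b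
  no-repeated-blocks b (b′ , b′≢b , b⊆b′ , b′⊆b) =
    let p , pb = point-on b
        d , b≢d , b∩d , q , qd , ¬qb = crossing-block b
        -- Both pairs intersect, the second because `b` is non-empty; so `g` fixes `b` and takes `d`
        -- to `b′`, and `q` on `d` would be carried into `b`.
        g , _ , e = intersecting-blocks (b , d) (b , b′)
          (b≢d , b∩d) (b′≢b ∘ sym , p , pb , b⊆b′ pb)
        gq∈b = b′⊆b (subst (onPoint g q I_) (cong proj₂ e) (preserves-I g qd))
    in ¬qb (reflects-I g (subst (onPoint g q I_) (sym (cong proj₁ e)) gq∈b))

  points-separated : ∀ p₁ p₂ → p₁ ≢ p₂ → ¬ ([ p₁ ]ᵖ ≐ [ p₂ ]ᵖ)
  points-separated p₁ p₂ p₁≢p₂ (p₁⊆p₂ , _) =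
    let b , p₁b = block-on p₁
        q , ¬qb = point-off b
        -- Here `g` fixes `p₁` and takes `q` to `p₂`, so the image of `b` contains `p₁` but not
        -- `p₂`.
        g , _ , e = distinct-points (p₁ , q) (p₁ , p₂) (separated⇒≢ᵖ p₁b ¬qb) p₁≢p₂
        p₂∈gb = p₁⊆p₂ (subst (_I onBlock g b) (cong proj₁ e) (preserves-I g p₁b))
    in ¬qb (reflects-I g (subst (_I onBlock g b) (sym (cong proj₂ e)) p₂∈gb))

  fixes-vertices : ∀ g → (∀ p → onPoint g p ≡ p) → (∀ b → onBlock g b ≡ b) →
    Group._≈_ Aut g (Group.ε Aut)
  fixes-vertices g fixP fixB (inj₁ p) = trans (proj₂ (points g p)) (cong inj₁ (fixP p))
  fixes-vertices g fixP fixB (inj₂ b) = trans (proj₂ (blocks g b)) (cong inj₂ (fixB b))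

  -- If `g` fixes every point, then a block and its image have the same points, so a moved block
  -- would be repeated.
  faithful-on-points : Faithful G pointAction
  faithful-on-points g _ fix = fixes-vertices g fix λ b →
    decidable-stable (onBlock g b FB.≟ b) λ gb≢b → no-repeated-blocks b
      ( onBlock g b , gb≢b
      , (λ {p} i → subst (_I onBlock g b) (fix p) (preserves-I g i))
      , (λ {p} i → reflects-I g (subst (_I onBlock g b) (sym (fix p)) i)))

  -- Dually, a moved point and its image would lie on the same blocks.
  faithful-on-blocks : Faithful G blockAction
  faithful-on-blocks g _ fix = fixes-vertices g
    (λ p → decidable-stable (onPoint g p FP.≟ p) λ gp≢p → points-separated p (onPoint g p)
      (gp≢p ∘ sym)
      ( (λ {b} i → subst (onPoint g p I_) (fix b) (preserves-I g i))
      , (λ {b} i → reflects-I g (subst (onPoint g p I_) (sym (fix b)) i))))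
    fix

  -- Orbits of stabilisers, and the rank on blocks.

  point-stabiliser-orbits : ∀ p → HasOrbits (stabiliser G pointAction p) blockAction 2
  point-stabiliser-orbits = stabiliser-2-orbits G pointAction blockAction _I_ _I?_
    (λ {g} _ → preserves-I g) (λ {g} _ → reflects-I g)
    incident-pairs nonincident-pairs block-on block-off

  block-stabiliser-orbits : ∀ b → HasOrbits (stabiliser G blockAction b) pointAction 2
  block-stabiliser-orbits = stabiliser-2-orbits G blockAction pointAction (flip _I_) (flip _I?_)
    (λ {g} _ → preserves-I g) (λ {g} _ → reflects-I g)
    (TransitiveOn-swap G pointAction blockAction incident-pairs)
    (TransitiveOn-swap G pointAction blockAction nonincident-pairs)
    point-on point-off

  block-stabiliser-orbits-on-blocks : HasNonIntersectingBlocks →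
    ∀ b → HasOrbits (stabiliser G blockAction b) blockAction 3
  block-stabiliser-orbits-on-blocks (b₀ , d₀ , b₀∦d₀) =
    stabiliser-orbits G blockAction blockAction R invariant transitive disjoint cover inhabited
    where
    R : Fin 3 → REL Block Block _
    R zero             = _≡_
    R (suc zero)       = λ b d → b ≢ d × Intersecting b d
    R (suc (suc zero)) = λ b d → ¬ Intersecting b d

    invariant : ∀ i {g b d} → g ∈ Member → R i b d → R i (onBlock g b) (onBlock g d)
    invariant zero             {g} _ = cong (onBlock g)
    invariant (suc zero)       {g} _ (b≢d , b∩d) =
      b≢d ∘ onBlock-injective g , preserves-Intersecting g b∩d
    invariant (suc (suc zero)) {g} _ ¬b∩d = ¬b∩d ∘ reflects-Intersecting g

    transitive : ∀ i → TransitiveOn G (blockAction ×-action blockAction) (λ (b , d) → R i b d)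
    transitive zero (b , _) (d , _) refl refl =
      let g , g∈ , gb = transitive-on-blocks b d in g , g∈ , cong₂ _,_ gb gb
    transitive (suc zero)       = intersecting-blocks
    transitive (suc (suc zero)) = nonintersecting-blocks

    -- Blocks are non-empty, so a non-intersecting pair is automatically distinct; this keeps the
    -- third class apart from the diagonal.
    self : ∀ b → Intersecting b b
    self b = let p , pb = point-on b in p , pb , pb

    disjoint : ∀ i j {b d} → R i b d → R j b d → i ≡ j
    disjoint zero             zero             _         _         = refl
    disjoint zero             (suc zero)       b≡d       (b≢d , _) = ⊥-elim (b≢d b≡d)
    disjoint zero             (suc (suc zero)) refl      ¬b∩d      = ⊥-elim (¬b∩d (self _))
    disjoint (suc zero)       zero             (b≢d , _) b≡d       = ⊥-elim (b≢d b≡d)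
    disjoint (suc zero)       (suc zero)       _         _         = refl
    disjoint (suc zero)       (suc (suc zero)) (_ , b∩d) ¬b∩d      = ⊥-elim (¬b∩d b∩d)
    disjoint (suc (suc zero)) zero             ¬b∩d      refl      = ⊥-elim (¬b∩d (self _))
    disjoint (suc (suc zero)) (suc zero)       ¬b∩d      (_ , b∩d) = ⊥-elim (¬b∩d b∩d)
    disjoint (suc (suc zero)) (suc (suc zero)) _         _         = refl

    cover : ∀ b d → ∃[ i ] R i b d
    cover b d with b FB.≟ d | intersecting? b d
    ... | yes b≡d | _        = zero , b≡d
    ... | no b≢d  | yes b∩d  = suc zero , b≢d , b∩d
    ... | no _    | no ¬b∩d  = suc (suc zero) , ¬b∩d

    inhabited : ∀ i b → ∃[ d ] R i b d
    inhabited zero             b = b , refl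
    inhabited (suc zero)       b = let d , b≢d , b∩d , _ = crossing-block b in d , b≢d , b∩d
    inhabited (suc (suc zero)) b =
      -- The hypothesis gives one disjoint pair; moving `b₀` to `b` produces a block disjoint from
      -- `b`.
      let g , _ , gb₀ = transitive-on-blocks b₀ b
      in onBlock g d₀ , λ i → b₀∦d₀ (reflects-Intersecting g
           (subst (λ b → Intersecting b (onBlock g d₀)) (sym gb₀) i))

  -- Search for a non-intersecting pair. If there is none, every pair of distinct blocks intersects,
  -- and transitivity on intersecting pairs is already 2-transitivity.
  block-action-rank : Is2Transitive (induced G blockAction)
    ⊎ (IsTransitiveOfRank (induced G blockAction) 3 × HasNonIntersectingBlocks)
  block-action-rank with FB.any? (λ b → FB.any? (λ d → ¬? (intersecting? b d)))
  ... | yes ∦ = inj₂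
    ( ( induced-transitive G blockAction transitive-on-blocks
      , λ b → induced-stabiliser-orbits G blockAction b (block-stabiliser-orbits-on-blocks ∦ b))
    , ∦)
  ... | no ∄∦ = inj₁ (induced-2-transitive G blockAction λ (b , d) (b′ , d′) b≢d b′≢d′ →
    intersecting-blocks (b , d) (b′ , d′) (b≢d , meet b d) (b′≢d′ , meet b′ d′))
    where
    meet : ∀ b d → Intersecting b d
    meet b d = decidable-stable (intersecting? b d) λ ¬b∩d → ∄∦ (b , d , ¬b∩d)

lemma2p2 : ∀ {m : Level} (D : Design) (let open Design D) (G : Subgroup Aut m) →
    IsNonTrivial2Design → PairwiseTransitive G →
    Connected
    × Is2Transitive (induced G pointAction)
    × (Is2Transitive (induced G blockAction)
    ⊎ (IsTransitiveOfRank (induced G blockAction) 3 × HasNonIntersectingBlocks))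
    × (∀ (p : Point) → HasOrbits (stabiliser G pointAction p) blockAction 2)
    × (∀ (b : Block) → HasOrbits (stabiliser G blockAction b) pointAction 2)
    × (∀ (b : Block) → ¬ Repeated b)
    × (∀ (p₁ p₂ : Point) → p₁ ≢ p₂ → ¬ ([ p₁ ]ᵖ ≐ [ p₂ ]ᵖ))
    × Faithful G pointAction
    × Faithful G blockAction
lemma2p2 D G nontrivial pt =
    connected
  , induced-2-transitive G pointAction (PairwiseTransitive.distinct-points pt)
  , block-action-rank
  , point-stabiliser-orbits
  , block-stabiliser-orbits
  , no-repeated-blocks
  , points-separated
  , faithful-on-points
  , faithful-on-blocks
  where
  open Design D
  open PairwiseTransitiveDesign D G nontrivial pt
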